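{- Let $R$ be a commutative ring with unity and let $m_1,m_2\ge1$ be integers. Let $\lambda_1:\mathbb N\times\mathbb Z\to R$ have triangular support of order $m_1$, let $\mu_1:\mathbb N\times\mathbb Z\to R$ have triangular support of order $m_2$, and put $$f_n(x)=\sum_{b=0}^{w_{m_1}(n)}\lambda_1(n,b)\,x^{n-m_1b},\qquad g_n(x)=\sum_{c=0}^{w_{m_2}(n)}\mu_1(n,c)\,x^{n-m_2c}\qquad(n\in\mathbb N).$$ Assume that there exist families $\lambda_3,\mu_3:\mathbb N\times\mathbb Z\to R$ with triangular support of orders $m_1$ and $m_2$ respectively such that, for all $n\ge0$, $$x^n=\sum_{b=0}^{w_{m_1}(n)}\lambda_3(n,b)\,f_{n-m_1b}(x),\qquad x^n=\sum_{c=0}^{w_{m_2}(n)}\mu_3(n,c)\,g_{n-m_2c}(x).$$ Then, for all $n\in\mathbb N$, $$f_n(x)=\sum_{r=0}^{n}g_r(x)\,Z(n;r),$$ where $$Z(n;r)=\sum_{\substack{0\le b\le w_{m_1}(n)\\ r\le n-m_1b\\ n-m_1b-r\equiv0\ (\mathrm{mod}\ m_2)}}\lambda_1(n,b)\;\mu_3\!\Bigl(n-m_1b,\ \frac{n-m_1b-r}{m_2}\Bigr).$$ In the particular case $m_1=m_2=m$, writing $r=n-mk$ with $0\le k\le w_m(n)$, one has $$Z(n;r)=\sum_{b=0}^{k}\lambda_1(n,b)\,\mu_3(n-mb,\,k-b).$$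
   Context: $\mathbb N=\{0,1,2,\dots\}$ and $w_m(n)=\lfloor n/m\rfloor$. A family $\lambda:\mathbb N\times\mathbb Z\to R$ has triangular support of order $m$ if $\lambda(n,k)=0$ whenever $k<0$ or $k>w_m(n)$. -}

module Defs where

open import Algebra.Bundles using (CommutativeRing; RawMonoid)
open import Algebra.Definitions.RawMonoid using (sum)
open import Data.Bool.Base using (if_then_else_)
open import Data.Fin.Base using (toℕ)
open import Data.Integer.Base as ℤ using (ℤ; +_; 0ℤ)
open import Data.List.Base using (List; []; _∷_; _++_; [_]; map; replicate)
open import Data.Nat.Base using (ℕ; zero; suc; NonZero; _∸_; _*_)
open import Data.Nat.Divisibility using (_∣?_)
open import Data.Nat.DivMod using (_/_)
open import Data.Nat.Properties using (_≤?_)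
open import Data.Sum.Base using (_⊎_)
open import Relation.Nullary.Decidable.Core using (does; _×-dec_)

w : (m : ℕ) .{{_ : NonZero m}} → ℕ → ℕ
w m n = n / m

-- f 0 + f 1 + … + f N, upper bound included.
∑≤ : ∀ {a ℓ} (M : RawMonoid a ℓ) → ℕ → (ℕ → RawMonoid.Carrier M) → RawMonoid.Carrier M
∑≤ M N f = sum M {suc N} (λ i → f (toℕ i))

module Over {c ℓ} (R : CommutativeRing c ℓ) where

  open CommutativeRing R using (Carrier; _≈_; 0#; 1#; +-rawMonoid)
    renaming (_+_ to _+ᴿ_; _*_ to _*ᴿ_)

  -- Formal polynomials R[x]: a₀ ∷ a₁ ∷ … ∷ [] is a₀ + a₁ x + ….  Trailing
  -- zeros are allowed, so equality is coefficientwise rather than that of lists.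
  Poly : Set c
  Poly = List Carrier

  coeff : Poly → ℕ → Carrier
  coeff []      _       = 0#
  coeff (a ∷ p) zero    = a
  coeff (a ∷ p) (suc i) = coeff p i

  infix  4 _≈ᴾ_
  infixl 6 _+ᴾ_
  infixr 7 _·ᴾ_

  _≈ᴾ_ : Poly → Poly → Set ℓ
  p ≈ᴾ q = ∀ i → coeff p i ≈ coeff q i

  _+ᴾ_ : Poly → Poly → Poly
  []      +ᴾ q       = q
  (a ∷ p) +ᴾ []      = a ∷ p
  (a ∷ p) +ᴾ (b ∷ q) = (a +ᴿ b) ∷ (p +ᴾ q)

  _·ᴾ_ : Carrier → Poly → Poly
  a ·ᴾ p = map (a *ᴿ_) p

  x^_ : ℕ → Poly
  x^ n = replicate n 0# ++ [ 1# ]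

  +ᴾ-rawMonoid : RawMonoid c ℓ
  +ᴾ-rawMonoid = record { Carrier = Poly ; _≈_ = _≈ᴾ_ ; _∙_ = _+ᴾ_ ; ε = [] }

  ∑ᴿ : ℕ → (ℕ → Carrier) → Carrier
  ∑ᴿ = ∑≤ +-rawMonoid

  ∑ᴾ : ℕ → (ℕ → Poly) → Poly
  ∑ᴾ = ∑≤ +ᴾ-rawMonoid

  infixl 5 ∑ᴿ ∑ᴾ
  syntax ∑ᴿ N (λ b → e) = ∑ᴿ[ b ≤ N ] e
  syntax ∑ᴾ N (λ b → e) = ∑ᴾ[ b ≤ N ] e

  Family : Set c
  Family = ℕ → ℤ → Carrier

  TriangularSupport : (m : ℕ) .{{_ : NonZero m}} → Family → Set ℓ
  TriangularSupport m α = ∀ n k → k ℤ.< 0ℤ ⊎ + (w m n) ℤ.< k → α n k ≈ 0#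

  -- Σ_{b=0}^{w_m(n)} α(n,b) p_{n-mb}.  Since b ≤ ⌊n/m⌋, the subtraction
  -- n ∸ m * b never truncates.
  combination : (m : ℕ) .{{_ : NonZero m}} → Family → (ℕ → Poly) → ℕ → Poly
  combination m α p n = ∑ᴾ[ b ≤ w m n ] (α n (+ b) ·ᴾ p (n ∸ m * b))

  polynomials : (m : ℕ) .{{_ : NonZero m}} → Family → ℕ → Poly
  polynomials m α = combination m α x^_

  -- The side conditions r ≤ n - m₁b and m₂ ∣ n - m₁b - r on the index b are
  -- imposed by replacing the excluded terms by 0; under them both truncated
  -- subtractions and the division are exact.
  Z : (m₁ m₂ : ℕ) .{{_ : NonZero m₁}} .{{_ : NonZero m₂}} →
      (λ₁ μ₃ : Family) → ℕ → ℕ → Carrier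
  Z m₁ m₂ λ₁ μ₃ n r =
    ∑ᴿ[ b ≤ w m₁ n ]
      (if does ((r ≤? n ∸ m₁ * b) ×-dec (m₂ ∣? (n ∸ m₁ * b ∸ r)))
       then λ₁ n (+ b) *ᴿ μ₃ (n ∸ m₁ * b) (+ ((n ∸ m₁ * b ∸ r) / m₂))
       else 0#)

{-# OPTIONS --safe #-}

-- Substituting xᴺ = Σ_c μ₃(N,c) g_{N-m₂c} into f_n gives a double sum over
-- (b,c); collecting the terms with n - m₁b - m₂c = r yields Z(n;r).
module Submission where

open import Defs
open import Algebra.Bundles using (CommutativeMonoid; CommutativeRing)
open import Data.Bool.Base using (Bool; true; false; if_then_else_)
open import Data.Fin.Base using (toℕ)
open import Data.Fin.Properties using (toℕ≤pred[n])
open import Data.Integer.Base as ℤ using (+_)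
open import Data.Integer.Properties using (m-n≡m⊖n; ⊖-≥)
open import Data.List.Base using ([]; _∷_)
open import Data.Nat.Base using
  (ℕ; zero; suc; pred; NonZero; _∸_; _*_; _≤_; _<_; _+_; z≤n; s≤s)
open import Data.Nat.Divisibility using (_∣_; _∣?_; m∣m*n)
open import Data.Nat.DivMod using (_/_; m*n/n≡m; m/n*n≤m; m*[n/m]≡n; /-monoˡ-≤)
open import Data.Nat.Properties using
  ( _≤?_; _≟_; ≤-trans; <⇒≱; m∸n≤m; *-comm; *-monoʳ-≤; *-monoʳ-<
  ; *-distribˡ-∸; m∸[m∸n]≡n; ∸-monoʳ-≤; ∸-monoʳ-<; ∸-+-assoc; +-comm )
open import Data.Product.Base using (_×_; _,_)
open import Function.Base using (_∘_)
open import Relation.Binary.PropositionalEquality.Core as ≡ using (_≡_; _≢_)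
open import Relation.Binary.PropositionalEquality.Properties using (module ≡-Reasoning)
open import Relation.Nullary.Decidable.Core using (Dec; yes; no; does; _×-dec_)
open import Relation.Nullary.Negation.Core using (¬_; contradiction)

-- Equality of polynomials is coefficientwise, so the identity is checked in `R` at a fixed degree
-- `i`. With `N b = n - m₁ b`, expanding each monomial of `f n` in the `g`s gives a double sum over
-- `(b, c)`. For fixed `b`, the map sending `c` to `r = N b - m₂ c` is a bijection from
-- `0..w m₂ (N b)` onto the `r ≤ N b` with `m₂` dividing `N b - r`, which are exactly the side
-- conditions in `Z`. This is `∑-reindex`. Its range `r ≤ n` does not depend on `b`, so the double
-- sum becomes rectangular, can be swapped, and has `Z n r` as the coefficient of `g r`. For equal
-- orders and `r = n - mk`, the side conditions reduce to `b ≤ k`, and the quotient is `k - b`.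

m*n/m≡n : ∀ m n .{{_ : NonZero m}} → m * n / m ≡ n
m*n/m≡n m n = ≡.trans (≡.cong (_/ m) (*-comm m n)) (m*n/n≡m n m)

-- Keeps `∸` exact for every index in a range bounded by `w m`.
n≤o/m⇒m*n≤o : ∀ m {n o} .{{_ : NonZero m}} → n ≤ o / m → m * n ≤ o
n≤o/m⇒m*n≤o m {n} {o} n≤o/m = ≤-trans (*-monoʳ-≤ m n≤o/m)
  (≡.subst (_≤ o) (*-comm (o / m) m) (m/n*n≤m o m))

-- Truncated subtractions commute, so `n ∸ m` can be subtracted first, leaving `m`.
[n∸o]∸[n∸m]≡m∸o : ∀ {m n} o → m ≤ n → n ∸ o ∸ (n ∸ m) ≡ m ∸ o
[n∸o]∸[n∸m]≡m∸o {m} {n} o m≤n = begin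
  n ∸ o ∸ (n ∸ m)    ≡⟨ ∸-+-assoc n o (n ∸ m) ⟩
  n ∸ (o + (n ∸ m))  ≡⟨ ≡.cong (n ∸_) (+-comm o (n ∸ m)) ⟩
  n ∸ (n ∸ m + o)    ≡⟨ ∸-+-assoc n (n ∸ m) o ⟨
  n ∸ (n ∸ m) ∸ o    ≡⟨ ≡.cong (_∸ o) (m∸[m∸n]≡n m≤n) ⟩
  m ∸ o              ∎
  where open ≡-Reasoning

module RangeSum {c ℓ} (M : CommutativeMonoid c ℓ) where

  open CommutativeMonoid M
    renaming (Carrier to A; _∙_ to _+_; ε to 0#; ∙-cong to +-cong; ∙-congˡ to +-congˡ)
  open import Algebra.Properties.CommutativeMonoid.Sum M using (sum-cong-≋; ∑-comm)
  open import Relation.Binary.Reasoning.Setoid setoid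

  ∑ : ℕ → (ℕ → A) → A
  ∑ = ∑≤ rawMonoid

  -- Each branch gets back the proof or refutation that `does` discards.
  if-dec : ∀ {p} {P : Set p} {x y z : A} (P? : Dec P) → (P → x ≈ z) → (¬ P → y ≈ z) →
           (if does P? then x else y) ≈ z
  if-dec (yes p) x≈z _ = x≈z p
  if-dec (no ¬p) _ y≈z = y≈z ¬p

  ∑-cong : ∀ N (f g : ℕ → A) → (∀ i → i ≤ N → f i ≈ g i) → ∑ N f ≈ ∑ N g
  ∑-cong N f g f≈g = sum-cong-≋ {suc N} (λ i → f≈g (toℕ i) (toℕ≤pred[n] i))

  ∑-swap : ∀ M N (f : ℕ → ℕ → A) → ∑ M (λ i → ∑ N (f i)) ≈ ∑ N (λ j → ∑ M (λ i → f i j))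
  ∑-swap M N f = ∑-comm {suc M} {suc N} (λ i j → f (toℕ i) (toℕ j))

  ∑-zero : ∀ N (f : ℕ → A) → (∀ i → i ≤ N → f i ≈ 0#) → ∑ N f ≈ 0#
  ∑-zero zero    f f≈0 = trans (identityʳ _) (f≈0 0 z≤n)
  ∑-zero (suc N) f f≈0 =
    trans (+-cong (f≈0 0 z≤n) (∑-zero N (f ∘ suc) (λ i i≤N → f≈0 (suc i) (s≤s i≤N)))) (identityˡ 0#)

  ∑-truncate : ∀ {k N} (f : ℕ → A) → k ≤ N → (∀ i → k < i → i ≤ N → f i ≈ 0#) →
               ∑ N f ≈ ∑ k f
  ∑-truncate {N = zero}  f z≤n _ = refl
  ∑-truncate {N = suc N} f z≤n f≈0 =
    +-congˡ (∑-zero N (f ∘ suc) (λ i i≤N → f≈0 (suc i) (s≤s z≤n) (s≤s i≤N)))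
  ∑-truncate f (s≤s k≤N) f≈0 =
    +-congˡ (∑-truncate (f ∘ suc) k≤N (λ i k<i i≤N → f≈0 (suc i) (s≤s k<i) (s≤s i≤N)))

  ∑-single : ∀ {i N} (f : ℕ → A) → i ≤ N → (∀ j → j ≤ N → j ≢ i → f j ≈ 0#) → ∑ N f ≈ f i
  ∑-single f z≤n f≈0 =
    trans (∑-truncate f z≤n λ { (suc j) _ j≤N → f≈0 (suc j) j≤N λ () }) (identityʳ _)
  ∑-single f (s≤s i≤N) f≈0 =
    trans (+-cong (f≈0 0 z≤n λ ())
                  (∑-single (f ∘ suc) i≤N (λ j j≤N j≢i → f≈0 (suc j) (s≤s j≤N) (j≢i ∘ ≡.cong pred))))
          (identityˡ _)

  -- Both sides are the sum of F c r over the pairs (r,c) with r = N - mc.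
  ∑-reindex : ∀ m .{{_ : NonZero m}} {N n} → N ≤ n → (F : ℕ → ℕ → A) →
    ∑ n (λ r → if does ((r ≤? N) ×-dec (m ∣? (N ∸ r))) then F ((N ∸ r) / m) r else 0#)
      ≈ ∑ (w m N) (λ c → F c (N ∸ m * c))
  ∑-reindex m {N} {n} N≤n F = begin
    ∑ n T
      ≈⟨ ∑-cong n T (λ r → ∑ (w m N) (D r)) (λ r _ → row r) ⟩
    ∑ n (λ r → ∑ (w m N) (D r))
      ≈⟨ ∑-swap n (w m N) D ⟩
    ∑ (w m N) (λ c → ∑ n (λ r → D r c))
      ≈⟨ ∑-cong (w m N) (λ c → ∑ n (λ r → D r c)) (λ c → F c (N ∸ m * c)) (λ c _ → column c) ⟩
    ∑ (w m N) (λ c → F c (N ∸ m * c)) ∎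
    where
    T : ℕ → A
    T r = if does ((r ≤? N) ×-dec (m ∣? (N ∸ r))) then F ((N ∸ r) / m) r else 0#

    -- The graph of `c ↦ N ∸ m * c`, weighted by `F`, as a matrix: its row sums give the left side
    -- and its column sums the right.
    D : ℕ → ℕ → A
    D r c = if does (r ≟ N ∸ m * c) then F c r else 0#

    D-on : ∀ r c → r ≡ N ∸ m * c → D r c ≈ F c r
    D-on r c eq = if-dec (r ≟ N ∸ m * c) (λ _ → refl) (λ neq → contradiction eq neq)

    D-off : ∀ r c → r ≢ N ∸ m * c → D r c ≈ 0#
    D-off r c neq = if-dec (r ≟ N ∸ m * c) (λ eq → contradiction eq neq) (λ _ → refl)

    -- Within the range the subtraction is exact, so `r` determines `c`: a row has at most one
    -- nonzero entry.
    N∸r≡m*c : ∀ r c → c ≤ w m N → r ≡ N ∸ m * c → N ∸ r ≡ m * c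
    N∸r≡m*c r c c≤w eq = ≡.trans (≡.cong (N ∸_) eq) (m∸[m∸n]≡n (n≤o/m⇒m*n≤o m c≤w))

    row : ∀ r → T r ≈ ∑ (w m N) (D r)
    row r = if-dec ((r ≤? N) ×-dec (m ∣? (N ∸ r)))
      (λ (r≤N , m∣N∸r) → sym (trans
        (∑-single (D r) (/-monoˡ-≤ m (m∸n≤m N r)) (λ c c≤w c≢ → D-off r c λ eq → c≢
          (≡.sym (≡.trans (≡.cong (_/ m) (N∸r≡m*c r c c≤w eq)) (m*n/m≡n m c)))))
        (D-on r ((N ∸ r) / m) (≡.sym (≡.trans (≡.cong (N ∸_) (m*[n/m]≡n m∣N∸r)) (m∸[m∸n]≡n r≤N))))))
      (λ ¬cond → sym (∑-zero (w m N) (D r) (λ c c≤w → D-off r c λ eq → ¬cond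
        ( ≡.subst (_≤ N) (≡.sym eq) (m∸n≤m N (m * c))
        , ≡.subst (m ∣_) (≡.sym (N∸r≡m*c r c c≤w eq)) (m∣m*n c)))))

    -- `N ≤ n` places the row `N ∸ m * c` inside the range of `r`.
    column : ∀ c → ∑ n (λ r → D r c) ≈ F c (N ∸ m * c)
    column c = trans (∑-single (λ r → D r c) (≤-trans (m∸n≤m N (m * c)) N≤n) (λ r _ → D-off r c))
                     (D-on (N ∸ m * c) c ≡.refl)

module _ {c ℓ} (R : CommutativeRing c ℓ) where

  open CommutativeRing R renaming (_+_ to _+ᴿ_; _*_ to _*ᴿ_)
  open Over R
  open RangeSum +-commutativeMonoid
  open import Algebra.Properties.Semiring.Sum semiring using (*-distribˡ-sum; *-distribʳ-sum)
  open import Relation.Binary.Reasoning.Setoid setoid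

  *-distribˡ-∑ : ∀ N a (f : ℕ → Carrier) → a *ᴿ ∑ᴿ N f ≈ ∑ᴿ N (λ i → a *ᴿ f i)
  *-distribˡ-∑ N a f = *-distribˡ-sum {suc N} a (f ∘ toℕ)

  *-distribʳ-∑ : ∀ N a (f : ℕ → Carrier) → ∑ᴿ N f *ᴿ a ≈ ∑ᴿ N (λ i → f i *ᴿ a)
  *-distribʳ-∑ N a f = *-distribʳ-sum {suc N} a (f ∘ toℕ)

  coeff-+ᴾ : ∀ p q i → coeff (p +ᴾ q) i ≈ coeff p i +ᴿ coeff q i
  coeff-+ᴾ []      q       i       = sym (+-identityˡ _)
  coeff-+ᴾ (a ∷ p) []      i       = sym (+-identityʳ _)
  coeff-+ᴾ (a ∷ p) (b ∷ q) zero    = refl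
  coeff-+ᴾ (a ∷ p) (b ∷ q) (suc i) = coeff-+ᴾ p q i

  coeff-·ᴾ : ∀ a p i → coeff (a ·ᴾ p) i ≈ a *ᴿ coeff p i
  coeff-·ᴾ a []      i       = sym (zeroʳ a)
  coeff-·ᴾ a (b ∷ p) zero    = refl
  coeff-·ᴾ a (b ∷ p) (suc i) = coeff-·ᴾ a p i

  coeff-∑ᴾ : ∀ N (p : ℕ → Poly) i → coeff (∑ᴾ N p) i ≈ ∑ᴿ N (λ b → coeff (p b) i)
  coeff-∑ᴾ zero    p i = coeff-+ᴾ (p 0) [] i
  coeff-∑ᴾ (suc N) p i = trans (coeff-+ᴾ (p 0) _ i) (+-congˡ (coeff-∑ᴾ N (p ∘ suc) i))

  -- The passage from polynomials to `R`, used for `f n`, for the expansion of a monomial and for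
  -- the target sum.
  coeff-∑ᴾ-·ᴾ : ∀ N (a : ℕ → Carrier) (p : ℕ → Poly) i →
                coeff (∑ᴾ[ b ≤ N ] (a b ·ᴾ p b)) i ≈ ∑ᴿ[ b ≤ N ] (a b *ᴿ coeff (p b) i)
  coeff-∑ᴾ-·ᴾ N a p i =
    trans (coeff-∑ᴾ N (λ b → a b ·ᴾ p b) i)
          (∑-cong N (λ b → coeff (a b ·ᴾ p b) i) (λ b → a b *ᴿ coeff (p b) i) (λ b _ → coeff-·ᴾ (a b) (p b) i))

  -- Moves the factor coming from `g r` under the side condition of `Z`, giving the summand the
  -- shape that `∑-reindex` expects.
  if-*-assoc : ∀ t x y z → (if t then x *ᴿ y else 0#) *ᴿ z ≈ (if t then x *ᴿ (y *ᴿ z) else 0#)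
  if-*-assoc true  x y z = *-assoc x y z
  if-*-assoc false x y z = zeroˡ z

  module _ (m₁ m₂ : ℕ) .{{_ : NonZero m₁}} .{{_ : NonZero m₂}} (λ₁ μ₃ : Family) where

    polynomials-∑-Z : (g : ℕ → Poly) → (∀ n → x^ n ≈ᴾ combination m₂ μ₃ g n) →
      ∀ n → polynomials m₁ λ₁ n ≈ᴾ ∑ᴾ[ r ≤ n ] (Z m₁ m₂ λ₁ μ₃ n r ·ᴾ g r)
    polynomials-∑-Z g expand n i = begin
      coeff (polynomials m₁ λ₁ n) i
        ≈⟨ coeff-∑ᴾ-·ᴾ W (λ b → λ₁ n (+ b)) (λ b → x^ N b) i ⟩
      ∑ᴿ[ b ≤ W ] (λ₁ n (+ b) *ᴿ coeff (x^ N b) i)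
        ≈⟨ ∑-cong W (λ b → λ₁ n (+ b) *ᴿ coeff (x^ N b) i) (λ b → ∑ᴿ n (ζg b)) (λ b _ → inner b) ⟩
      ∑ᴿ[ b ≤ W ] ∑ᴿ[ r ≤ n ] ζg b r
        ≈⟨ ∑-swap W n ζg ⟩
      ∑ᴿ[ r ≤ n ] ∑ᴿ[ b ≤ W ] ζg b r
        ≈⟨ ∑-cong n (λ r → Z m₁ m₂ λ₁ μ₃ n r *ᴿ coeff (g r) i) (λ r → ∑ᴿ[ b ≤ W ] ζg b r)
             (λ r _ → *-distribʳ-∑ W (coeff (g r) i) (λ b → ζ b r)) ⟨
      ∑ᴿ[ r ≤ n ] (Z m₁ m₂ λ₁ μ₃ n r *ᴿ coeff (g r) i)
        ≈⟨ coeff-∑ᴾ-·ᴾ n (Z m₁ m₂ λ₁ μ₃ n) g i ⟨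
      coeff (∑ᴾ[ r ≤ n ] (Z m₁ m₂ λ₁ μ₃ n r ·ᴾ g r)) i ∎
      where
      W : ℕ
      W = w m₁ n

      N : ℕ → ℕ
      N b = n ∸ m₁ * b

      cond : ℕ → ℕ → Bool
      cond b r = does ((r ≤? N b) ×-dec (m₂ ∣? (N b ∸ r)))

      ζ : ℕ → ℕ → Carrier
      ζ b r = if cond b r then λ₁ n (+ b) *ᴿ μ₃ (N b) (+ ((N b ∸ r) / m₂)) else 0#

      ζg : ℕ → ℕ → Carrier
      ζg b r = ζ b r *ᴿ coeff (g r) i

      inner : ∀ b → λ₁ n (+ b) *ᴿ coeff (x^ N b) i ≈ ∑ᴿ[ r ≤ n ] ζg b r
      inner b = begin
        λ₁ n (+ b) *ᴿ coeff (x^ N b) i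
          ≈⟨ *-congˡ (trans (expand (N b) i)
               (coeff-∑ᴾ-·ᴾ V (λ c → μ₃ (N b) (+ c)) (λ c → g (N b ∸ m₂ * c)) i)) ⟩
        λ₁ n (+ b) *ᴿ (∑ᴿ[ c ≤ V ] (μ₃ (N b) (+ c) *ᴿ coeff (g (N b ∸ m₂ * c)) i))
          ≈⟨ *-distribˡ-∑ V (λ₁ n (+ b)) (λ c → μ₃ (N b) (+ c) *ᴿ coeff (g (N b ∸ m₂ * c)) i) ⟩
        ∑ᴿ[ c ≤ V ] F c (N b ∸ m₂ * c)
          -- Since `N b ≤ n`, every `b` gets the same range for `r`; the later swap relies on this.
          ≈⟨ ∑-reindex m₂ (m∸n≤m n (m₁ * b)) F ⟨
        ∑ᴿ[ r ≤ n ] (if cond b r then F ((N b ∸ r) / m₂) r else 0#)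
          ≈⟨ ∑-cong n (ζg b) (λ r → if cond b r then F ((N b ∸ r) / m₂) r else 0#) (λ r _ →
               if-*-assoc (cond b r) (λ₁ n (+ b)) (μ₃ (N b) (+ ((N b ∸ r) / m₂))) (coeff (g r) i)) ⟨
        ∑ᴿ[ r ≤ n ] ζg b r ∎
        where
        V : ℕ
        V = w m₂ (N b)

        F : ℕ → ℕ → Carrier
        F c r = λ₁ n (+ b) *ᴿ (μ₃ (N b) (+ c) *ᴿ coeff (g r) i)

  Z-equal-orders : ∀ m .{{_ : NonZero m}} (λ₁ μ₃ : Family) n k → k ≤ w m n →
    Z m m λ₁ μ₃ n (n ∸ m * k) ≈ ∑ᴿ[ b ≤ k ] (λ₁ n (+ b) *ᴿ μ₃ (n ∸ m * b) (+ k ℤ.- + b))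
  Z-equal-orders m λ₁ μ₃ n k k≤w = trans
    (∑-truncate T k≤w excluded)
    (∑-cong k T (λ b → λ₁ n (+ b) *ᴿ μ₃ (n ∸ m * b) (+ k ℤ.- + b)) included)
    where
    mk≤n : m * k ≤ n
    mk≤n = n≤o/m⇒m*n≤o m k≤w

    cond? : ∀ b → Dec (n ∸ m * k ≤ n ∸ m * b × m ∣ n ∸ m * b ∸ (n ∸ m * k))
    cond? b = (n ∸ m * k ≤? n ∸ m * b) ×-dec (m ∣? (n ∸ m * b ∸ (n ∸ m * k)))

    T : ℕ → Carrier
    T b = if does (cond? b)
          then λ₁ n (+ b) *ᴿ μ₃ (n ∸ m * b) (+ ((n ∸ m * b ∸ (n ∸ m * k)) / m))
          else 0#

    excluded : ∀ b → k < b → b ≤ w m n → T b ≈ 0#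
    excluded b k<b b≤w = if-dec (cond? b)
      -- As `m * b ≤ n`, nothing truncates, so `k < b` gives `n - mb < n - mk` strictly.
      (λ (r≤ , _) → contradiction r≤ (<⇒≱ (∸-monoʳ-< (*-monoʳ-< m k<b) (n≤o/m⇒m*n≤o m b≤w))))
      (λ _ → refl)

    gap : ∀ b → n ∸ m * b ∸ (n ∸ m * k) ≡ m * (k ∸ b)
    gap b = ≡.trans ([n∸o]∸[n∸m]≡m∸o (m * b) mk≤n)
                    (≡.sym (*-distribˡ-∸ m k b))

    index : ∀ {b} → b ≤ k → + ((n ∸ m * b ∸ (n ∸ m * k)) / m) ≡ + k ℤ.- + b
    index {b} b≤k = ≡.trans
      (≡.cong +_ (≡.trans (≡.cong (_/ m) (gap b)) (m*n/m≡n m (k ∸ b))))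
      -- The integer difference is the natural one because `b ≤ k`.
      (≡.sym (≡.trans (m-n≡m⊖n k b) (⊖-≥ b≤k)))

    included : ∀ b → b ≤ k → T b ≈ λ₁ n (+ b) *ᴿ μ₃ (n ∸ m * b) (+ k ℤ.- + b)
    included b b≤k = if-dec (cond? b)
      (λ _ → *-congˡ (reflexive (≡.cong (μ₃ (n ∸ m * b)) (index b≤k))))
      -- For `b ≤ k` both side conditions hold, so the default `0#` never occurs.
      (λ ¬cond → contradiction
        ( ∸-monoʳ-≤ n (*-monoʳ-≤ m b≤k)
        , ≡.subst (m ∣_) (≡.sym (gap b)) (m∣m*n (k ∸ b)))
        ¬cond)

theorem2p9 : ∀ {c ℓ} (R : CommutativeRing c ℓ) →
  let open CommutativeRing R using (_≈_) renaming (_*_ to _*ᴿ_)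
      open Over R
  in
  (m₁ m₂ : ℕ) .{{_ : NonZero m₁}} .{{_ : NonZero m₂}} →
  (λ₁ μ₁ : Family) → TriangularSupport m₁ λ₁ → TriangularSupport m₂ μ₁ →
  let f = polynomials m₁ λ₁
      g = polynomials m₂ μ₁
  in
  (λ₃ μ₃ : Family) → TriangularSupport m₁ λ₃ → TriangularSupport m₂ μ₃ →
  (∀ n → x^ n ≈ᴾ combination m₁ λ₃ f n) →
  (∀ n → x^ n ≈ᴾ combination m₂ μ₃ g n) →
  (∀ n → f n ≈ᴾ ∑ᴾ[ r ≤ n ] (Z m₁ m₂ λ₁ μ₃ n r ·ᴾ g r))
  ×
  (m₁ ≡ m₂ → ∀ n k → k ≤ w m₁ n →
    Z m₁ m₂ λ₁ μ₃ n (n ∸ m₁ * k)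
      ≈ ∑ᴿ[ b ≤ k ] (λ₁ n (+ b) *ᴿ μ₃ (n ∸ m₁ * b) (+ k ℤ.- + b)))
theorem2p9 R m₁ m₂ {{nz₁}} {{nz₂}} λ₁ μ₁ _ _ λ₃ μ₃ _ _ _ expand =
    polynomials-∑-Z R m₁ m₂ λ₁ μ₃ (Over.polynomials R m₂ μ₁) expand
  -- Once the orders are identified, `nz₁` and `nz₂` concern the same number; being irrelevant, they
  -- yield the same `Z`.
  , λ { ≡.refl → Z-equal-orders R m₁ {{nz₂}} λ₁ μ₃ }
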